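{- Let $\mathcal{G}=(V,E,\lambda)$ be a happy compressed temporal graph. If $\mathcal{G}$ is acyclic (has no temporal cycle), then its footprint $(V,E)$ is triangle-free.
   Context: A happy temporal graph is a triple $\mathcal{G}=(V,E,\lambda)$ where $(V,E)$ is a finite simple undirected graph (the footprint) and $\lambda:E\to\{1,2,3,\dots\}$ assigns a single time label to each edge, such that two distinct edges sharing an endpoint have different labels. It is compressed if for every edge $e$ with $\lambda(e)>1$ there is an edge $e'$ adjacent to $e$ with $\lambda(e')=\lambda(e)-1$. A temporal walk is a walk in the footprint along which edge labels are strictly increasing (so no edge is repeated). A temporal cycle is a nonempty temporal walk from a vertex to itself; $\mathcal{G}$ is acyclic if it has no temporal cycle. -}

module Defs where

open import Data.Fin.Base using (Fin)
open import Data.List.Base using (List; []; _∷_)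
open import Data.List.Relation.Unary.Linked using (Linked)
open import Data.Nat.Base using (ℕ; _∸_; _≤_; _<_)
open import Data.Product.Base using (_×_; ∃-syntax; Σ-syntax)
open import Data.Sum.Base using (_⊎_)
open import Function.Base using (_on_)
open import Level using (0ℓ)
open import Relation.Binary.Construct.Closure.ReflexiveTransitive
  using (Star; ε; _◅_)
open import Relation.Binary.Core using (Rel)
open import Relation.Binary.Definitions using (Symmetric; Irreflexive; Decidable)
open import Relation.Binary.PropositionalEquality.Core using (_≡_; _≢_)
open import Relation.Nullary.Negation.Core using (¬_)

record SimpleGraph (n : ℕ) : Set₁ where
  infix 4 _~_
  field
    _~_      : Rel (Fin n) 0ℓ
    ~-sym    : Symmetric _~_
    ~-irrefl : Irreflexive _≡_ _~_
    _~?_     : Decidable _~_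

  -- An element of Edge is an oriented presentation of an undirected edge;
  -- E itself is Edge up to _≈_, which ignores both the orientation and
  -- the proof of adjacency.
  record Edge : Set where
    constructor edge
    field
      {src tgt} : Fin n
      joined    : src ~ tgt

  open Edge public

  infix 4 _≈_
  _≈_ : Rel Edge 0ℓ
  e ≈ f = (src e ≡ src f × tgt e ≡ tgt f) ⊎ (src e ≡ tgt f × tgt e ≡ src f)

  _IsEndpointOf_ : Fin n → Edge → Set
  v IsEndpointOf e = v ≡ src e ⊎ v ≡ tgt e

  Adjacent : Rel Edge 0ℓ
  Adjacent e f = ¬ (e ≈ f) × ∃[ v ] (v IsEndpointOf e × v IsEndpointOf f)

  Walk : Rel (Fin n) 0ℓ
  Walk = Star _~_

  edges : ∀ {u v} → Walk u v → List Edge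
  edges ε       = []
  edges (p ◅ w) = edge p ∷ edges w

  -- The three vertices are automatically distinct, by ~-irrefl.
  TriangleFree : Set
  TriangleFree = ¬ (∃[ a ] ∃[ b ] ∃[ c ] (a ~ b × b ~ c × c ~ a))

record HappyTemporalGraph (n : ℕ) : Set₁ where
  field
    footprint : SimpleGraph n

  open SimpleGraph footprint public

  field
    label      : Edge → ℕ
    label-cong : ∀ {e f} → e ≈ f → label e ≡ label f
    label-pos  : ∀ e → 1 ≤ label e
    happy      : ∀ {e f} → Adjacent e f → label e ≢ label f

  Compressed : Set
  Compressed = ∀ e → 1 < label e → ∃[ f ] (Adjacent f e × label f ≡ label e ∸ 1)

  IsTemporal : ∀ {u v} → Walk u v → Set
  IsTemporal w = Linked (_<_ on label) (edges w)

  TemporalCycle : Set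
  TemporalCycle = ∃[ v ] Σ[ w ∈ Walk v v ] (edges w ≢ [] × IsTemporal w)

  Acyclic : Set
  Acyclic = ¬ TemporalCycle

{-# OPTIONS --safe #-}

-- The three labels of a triangle are pairwise distinct, and traversing its
-- edges in increasing order of label, in whatever order they come, is a closed
-- walk.  So a triangle is always a temporal cycle.
module Submission where

open import Defs
open import Data.List.Relation.Unary.Linked using ([-]; _∷_)
open import Data.Nat.Base using (ℕ; _<_)
open import Data.Nat.Properties using (<-asym; <-cmp; <-trans)
open import Data.Product.Base using (_,_)
open import Data.Sum.Base using (_⊎_; inj₁; inj₂)
open import Relation.Binary.Construct.Closure.ReflexiveTransitive using (ε; _◅_)
open import Relation.Binary.Definitions using (tri<; tri≈; tri>)
open import Relation.Binary.PropositionalEquality.Core using (refl; sym; subst₂)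
open import Relation.Nullary.Negation.Core using (contradiction)

module _ {n : ℕ} (G : HappyTemporalGraph n) where
  open HappyTemporalGraph G

  -- Were the two edges equal up to orientation, `p` would be a loop (`a ≡ b`) or the closing edge
  -- would be one (`a ≡ c`).
  triangle-adjacent : ∀ {a b c} (p : a ~ b) (q : b ~ c) → c ~ a →
    Adjacent (edge p) (edge q)
  triangle-adjacent {b = b} p q r =
    (λ { (inj₁ (a≡b , _)) → ~-irrefl a≡b p
       ; (inj₂ (a≡c , _)) → ~-irrefl (sym a≡c) r })
    , b , inj₂ refl , inj₁ refl

  triangle-labels-comparable : ∀ {a b c} (p : a ~ b) (q : b ~ c) → c ~ a →
    label (edge p) < label (edge q) ⊎ label (edge q) < label (edge p)
  triangle-labels-comparable p q r with <-cmp (label (edge p)) (label (edge q))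
  ... | tri< p<q _ _ = inj₁ p<q
  ... | tri≈ _ p≡q _ = contradiction p≡q (happy (triangle-adjacent p q r))
  ... | tri> _ _ q<p = inj₂ q<p

  -- Labels belong to undirected edges, so `label-cong` carries the comparison over to the reversed
  -- edges. This allows a triangle to be walked in either direction.
  reverse-< : ∀ {a b c d} (p : a ~ b) (q : c ~ d) →
    label (edge p) < label (edge q) →
    label (edge (~-sym p)) < label (edge (~-sym q))
  reverse-< p q = subst₂ _<_ (label-cong (inj₂ (refl , refl)))
                             (label-cong (inj₂ (refl , refl)))

  increasing-triangle⇒cycle : ∀ {a b c} (p : a ~ b) (q : b ~ c) (r : c ~ a) →
    label (edge p) < label (edge q) → label (edge q) < label (edge r) →
    TemporalCycle
  increasing-triangle⇒cycle {a} p q r p<q q<r =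
    a , p ◅ q ◅ r ◅ ε , (λ ()) , p<q ∷ q<r ∷ [-]

  min-first-triangle⇒cycle : ∀ {a b c} (p : a ~ b) (q : b ~ c) (r : c ~ a) →
    label (edge p) < label (edge q) → label (edge p) < label (edge r) →
    TemporalCycle
  min-first-triangle⇒cycle p q r p<q p<r with triangle-labels-comparable q r p
  ... | inj₁ q<r = increasing-triangle⇒cycle p q r p<q q<r
  -- Here the order is `p`, `r`, `q`: start at `b` instead of `a` and go round the other way, `b`,
  -- `a`, `c`, `b`.
  ... | inj₂ r<q = increasing-triangle⇒cycle (~-sym p) (~-sym r) (~-sym q)
                     (reverse-< p r p<r) (reverse-< r q r<q)

  -- The triangle is rotated so that its edge of least label comes first; the first three cases are
  -- the three possible positions of that edge.
  triangle⇒cycle : ∀ {a b c} → a ~ b → b ~ c → c ~ a → TemporalCycle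
  triangle⇒cycle p q r
    with triangle-labels-comparable p q r | triangle-labels-comparable q r p
       | triangle-labels-comparable r p q
  ... | inj₁ p<q | _        | inj₂ p<r = min-first-triangle⇒cycle p q r p<q p<r
  ... | inj₂ q<p | inj₁ q<r | _        = min-first-triangle⇒cycle q r p q<r q<p
  ... | _        | inj₂ r<q | inj₁ r<p = min-first-triangle⇒cycle r p q r<p r<q
  -- In the two remaining cases no edge is least: the comparisons run in a circle, which a strict
  -- order forbids.
  ... | inj₁ p<q | inj₁ q<r | inj₁ r<p = contradiction r<p (<-asym (<-trans p<q q<r))
  ... | inj₂ q<p | inj₂ r<q | inj₂ p<r = contradiction p<r (<-asym (<-trans r<q q<p))

lemma3p3 : ∀ {n : ℕ} (G : HappyTemporalGraph n) →
    HappyTemporalGraph.Compressed G →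
    HappyTemporalGraph.Acyclic G →
    SimpleGraph.TriangleFree (HappyTemporalGraph.footprint G)
lemma3p3 G _ acyclic (_ , _ , _ , p , q , r) = acyclic (triangle⇒cycle G p q r)
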